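{- Let $G$ be a connected graph with $n(G)\ge 2$, and let $H$ be a graph with $\mathrm{diam}(H)=2$ and $o(H)=\mathcal{R}$. Then $$R_{\rm MB}(G\odot H)\le R_{\rm MB}'(G\odot H)\le n(G)\,R_{\rm MB}'(H).$$ If, in addition, $R_{\rm MB}(H)=R_{\rm MB}'(H)$, then $$R_{\rm MB}(G\odot H)=R_{\rm MB}'(G\odot H)=n(G)\,R_{\rm MB}(H).$$
   Context: All graphs are finite and simple; $n(X)=|V(X)|$, and $\mathrm{diam}(X)$ is the largest shortest-path distance between two vertices of $X$. The corona product $G\odot H$ of a connected graph $G$ and a graph $H$ is obtained from one copy of $G$ and $n(G)$ disjoint copies of $H$ by joining the $i$-th vertex of $G$ to every vertex of the $i$-th copy of $H$. A set $W\subseteq V(X)$ of a connected graph $X$ is a resolving set of $X$ if for every two distinct vertices $x,y$ of $X$ there is $z\in W$ such that the shortest-path distances $d_X(x,z)$ and $d_X(y,z)$ differ. The Maker-Breaker resolving game on a connected graph $X$ is played by two players, Resolver and Spoiler, who alternately select a not yet played vertex of $X$. Resolver wins if he selects all the vertices of some resolving set of $X$; Spoiler wins if she prevents this, i.e. if she selects at least one vertex from every resolving set of $X$. In the R-game Resolver moves first; in the S-game Spoiler moves first. The outcome $o(X)$ is: $\mathcal{R}$ if Resolver has a winning strategy no matter who starts the game; $\mathcal{S}$ if Spoiler has a winning strategy no matter who starts the game; $\mathcal{N}$ if the first player has a winning strategy (no matter which of the two players that is). The Maker-Breaker resolving number $R_{\rm MB}(X)$ is the minimum number of moves of Resolver to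 win the R-game on $X$ when both players play optimally (Resolver to win as fast as possible, Spoiler to delay this as long as possible); $R_{\rm MB}'(X)$ is the corresponding number of moves of Resolver for the S-game. (When $o(X)=\mathcal{R}$ both numbers are well defined.) -}

module Defs where

open import Data.Nat using (ℕ; zero; suc; _+_; _*_; _≤_)
open import Data.Fin using (Fin; splitAt; remQuot)
open import Data.Fin.Properties using (_≟_)
open import Data.Fin.Subset using (Subset; ⊥; ⁅_⁆; _∪_; _∈_; _∉_; _⊆_)
open import Data.Product using (_×_; _,_; ∃; ∃-syntax)
open import Data.Sum using (_⊎_; inj₁; inj₂)
open import Level using (0ℓ)
open import Relation.Binary.Core using (Rel)
open import Relation.Binary.Definitions using (Decidable; Symmetric)
open import Relation.Binary.PropositionalEquality using (_≡_; _≢_; sym)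
open import Relation.Nullary using (¬_)
open import Relation.Nullary.Decidable using (_×-dec_)

-- Finite simple graphs with n vertices.  Decidability of adjacency is part of
-- the data because a finite graph is classically always decidable.
record Graph (n : ℕ) : Set₁ where
  field
    Adj         : Rel (Fin n) 0ℓ
    adj?        : Decidable Adj
    symmetric   : Symmetric Adj
    irreflexive : ∀ v → ¬ Adj v v

open Graph public

private
  variable
    n m : ℕ

------------------------------------------------------------------------
-- Distances

data Walk (X : Graph n) : Fin n → Fin n → ℕ → Set where
  []  : ∀ {x} → Walk X x x zero
  _∷_ : ∀ {x y z k} → Adj X x y → Walk X y z k → Walk X x z (suc k)

Connected : Graph n → Set
Connected X = ∀ x y → ∃[ k ] Walk X x y k

-- The distance is a relation, so it is undefined between different components.
-- A walk of minimum length is automatically a path.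
Distance : Graph n → Fin n → Fin n → ℕ → Set
Distance X x y d = Walk X x y d × (∀ k → Walk X x y k → d ≤ k)

-- A graph having a diameter in this sense is connected.
Diameter : Graph n → ℕ → Set
Diameter X D =
  (∀ x y → ∃[ d ] (Distance X x y d × d ≤ D)) ×
  (∃[ x ] ∃[ y ] Distance X x y D)

Resolving : Graph n → Subset n → Set
Resolving X W =
  ∀ x y → x ≢ y →
  ∃[ z ] (z ∈ W × ∃[ d ] ∃[ e ] (Distance X x z d × Distance X y z e × d ≢ e))

------------------------------------------------------------------------
-- Corona products

-- inj₁ i is the i-th vertex of G, and inj₂ (i , u) is the vertex u of the
-- i-th copy of H.
CoronaVertex : ℕ → ℕ → Set
CoronaVertex n m = Fin n ⊎ (Fin n × Fin m)

CoronaAdj : Graph n → Graph m → Rel (CoronaVertex n m) 0ℓ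
CoronaAdj G H (inj₁ i)       (inj₁ j)       = Adj G i j
CoronaAdj G H (inj₁ i)       (inj₂ (j , v)) = i ≡ j
CoronaAdj G H (inj₂ (i , u)) (inj₁ j)       = i ≡ j
CoronaAdj G H (inj₂ (i , u)) (inj₂ (j , v)) = i ≡ j × Adj H u v

-- The library bijection Fin (n + n * m) ≅ Fin n ⊎ (Fin n × Fin m).
decode : ∀ n m → Fin (n + n * m) → CoronaVertex n m
decode n m v with splitAt n v
... | inj₁ i = inj₁ i
... | inj₂ w = inj₂ (remQuot m w)

infix 7 _⊙_

_⊙_ : Graph n → Graph m → Graph (n + n * m)
_⊙_ {n} {m} G H = record
  { Adj         = λ v w → CoronaAdj G H (decode n m v) (decode n m w)
  ; adj?        = λ v w → dec (decode n m v) (decode n m w)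
  ; symmetric   = λ {v} {w} → symm (decode n m v) (decode n m w)
  ; irreflexive = λ v → irr (decode n m v)
  }
  where
  dec : Decidable (CoronaAdj G H)
  dec (inj₁ i)       (inj₁ j)       = adj? G i j
  dec (inj₁ i)       (inj₂ (j , v)) = i ≟ j
  dec (inj₂ (i , u)) (inj₁ j)       = i ≟ j
  dec (inj₂ (i , u)) (inj₂ (j , v)) = (i ≟ j) ×-dec adj? H u v

  symm : ∀ a b → CoronaAdj G H a b → CoronaAdj G H b a
  symm (inj₁ i)       (inj₁ j)       a       = symmetric G a
  symm (inj₁ i)       (inj₂ (j , v)) p       = sym p
  symm (inj₂ (i , u)) (inj₁ j)       p       = sym p
  symm (inj₂ (i , u)) (inj₂ (j , v)) (p , a) = sym p , symmetric H a

  irr : ∀ a → ¬ CoronaAdj G H a a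
  irr (inj₁ i)       a       = irreflexive G i a
  irr (inj₂ (i , u)) (_ , a) = irreflexive H u a

------------------------------------------------------------------------
-- The Maker-Breaker resolving game

data Player : Set where
  resolver spoiler : Player

opponent : Player → Player
opponent resolver = spoiler
opponent spoiler  = resolver

record Position (n : ℕ) : Set where
  constructor ⟨_,_⟩
  field
    byResolver bySpoiler : Subset n

open Position public

start : Position n
start = ⟨ ⊥ , ⊥ ⟩

Free : Position n → Fin n → Set
Free P v = v ∉ byResolver P × v ∉ bySpoiler P

select : Player → Fin n → Position n → Position n
select resolver v ⟨ A , B ⟩ = ⟨ A ∪ ⁅ v ⁆ , B ⟩
select spoiler  v ⟨ A , B ⟩ = ⟨ A , B ∪ ⁅ v ⁆ ⟩

Won : Graph n → Player → Position n → Set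
Won X resolver P = ∃[ W ] (Resolving X W × W ⊆ byResolver P)
Won X spoiler  P = ∀ W → Resolving X W → ∃[ v ] (v ∈ W × v ∈ bySpoiler P)

-- An element of  Strategy X p k t P  is a strategy tree by which player p,
-- with t to move in position P, wins after at most k further moves of p.
-- In  reply  a free vertex is required: on a full board the game is over, and
-- p must not win vacuously there.
data Strategy (X : Graph n) (p : Player) : ℕ → Player → Position n → Set where
  won   : ∀ {k t P} → Won X p P → Strategy X p k t P
  move  : ∀ {k P} v → Free P v →
          Strategy X p k (opponent p) (select p v P) →
          Strategy X p (suc k) p P
  reply : ∀ {k P} → ∃ (Free P) →
          (∀ v → Free P v → Strategy X p k p (select (opponent p) v P)) →
          Strategy X p k (opponent p) P

WinsWithin : Graph n → (p first : Player) → ℕ → Set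
WinsWithin X p first k = Strategy X p k first start

-- The board is finite, so every winning strategy has a bound k.
HasWinningStrategy : Graph n → (p first : Player) → Set
HasWinningStrategy X p first = ∃[ k ] WinsWithin X p first k

data Outcome : Set where
  𝓡 𝓢 𝓝 : Outcome

HasOutcome : Graph n → Outcome → Set
HasOutcome X 𝓡 = ∀ first → HasWinningStrategy X resolver first
HasOutcome X 𝓢 = ∀ first → HasWinningStrategy X spoiler first
HasOutcome X 𝓝 = ∀ first → HasWinningStrategy X first first

-- The minimum is a relation between X and k; it has no value when Resolver
-- has no winning strategy, and at most one value otherwise.
IsMinMoves : Graph n → (first : Player) → ℕ → Set
IsMinMoves X first k =
  WinsWithin X resolver first k ×
  (∀ j → WinsWithin X resolver first j → k ≤ j)

R-MB≡ : Graph n → ℕ → Set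
R-MB≡ X k = IsMinMoves X resolver k

R′-MB≡ : Graph n → ℕ → Set
R′-MB≡ X k = IsMinMoves X spoiler k

{-# OPTIONS --safe #-}

-- Two vertices in the same copy of H have the same distance to every vertex
-- outside that copy, and since diam H = 2 the distances inside a copy are those
-- of H.  As n(G) ≥ 2, a set is therefore resolving in G ⊙ H iff its trace on
-- every copy is resolving in H, and the game on G ⊙ H is n(G) simultaneous games
-- on H, all of which Resolver must win, with the vertices of G as wasted moves.
-- Answering Spoiler in the copy where she has just played gives
-- R′(G ⊙ H) ≤ n(G) R′(H).  If Spoiler in turn always answers Resolver in the copy
-- where he has just played, she forces n(G) R(H) ≤ R(G ⊙ H).  An additional move
-- never harms either player, which gives R ≤ R′ and covers the moves for which no
-- answer in the same copy is possible.
module Submission where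

open import Algebra.Properties.Monoid.Sum using (sum)
open import Data.Fin using (Fin; zero; suc; fromℕ<; _↑ˡ_; _↑ʳ_; combine; splitAt)
open import Data.Fin.Properties
  using (_≟_; any?; all?; ¬∀⟶∃¬; splitAt-↑ˡ; splitAt-↑ʳ; splitAt⁻¹-↑ˡ; splitAt⁻¹-↑ʳ;
         remQuot-combine; combine-remQuot)
open import Data.Fin.Subset using (Subset; ⊥; ⁅_⁆; _∪_; _∈_; _∉_; _⊆_)
open import Data.Fin.Subset.Properties
  using (_∈?_; ∉⊥; ⊥⊆; x∈⁅x⁆; x∈⁅y⁆⇒x≡y; ⊆-refl; ⊆-antisym; p⊆p∪q; q⊆p∪q; x∈p∪q⁻)
open import Data.List using (allFin)
open import Data.List.Extrema.Nat using (argmax; f[xs]≤f[argmax])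
open import Data.List.Membership.Propositional.Properties using (∈-allFin)
import Data.List.Relation.Unary.All as All
open import Data.Nat using (ℕ; zero; suc; _+_; _*_; _≤_; _<_; z≤n; s≤s; s≤s⁻¹)
open import Data.Nat.Properties as ℕ
  using (+-0-monoid; ≤-refl; ≤-trans; ≤-antisym; +-mono-≤; +-mono-<-≤; +-mono-≤-<)
open import Data.Product using (_×_; _,_; proj₁; proj₂; ∃; ∃-syntax; uncurry)
open import Data.Sum using (_⊎_; inj₁; inj₂; [_,_]′)
open import Data.Sum.Properties using (inj₂-injective)
open import Data.Vec using (lookup; tabulate)
open import Data.Vec.Properties using (lookup⇒[]=; []=⇒lookup; lookup∘tabulate)
open import Function using (_∘_)
open import Level using (0ℓ)
open import Relation.Binary.Definitions using (tri<; tri≈; tri>)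
open import Relation.Binary.PropositionalEquality
  using (_≡_; _≢_; refl; sym; trans; cong; subst; subst₂)
open import Relation.Nullary using (¬_; Dec; yes; no; contradiction)
open import Relation.Nullary.Decidable using (map′; ¬?; _×-dec_; _⊎-dec_; _→-dec_)
open import Relation.Unary using (Pred; Decidable)
open import Defs

private
  variable
    n m k k′ K : ℕ
    X : Graph n
    p t : Player
    P Q : Position n

-- Sums, minima and maxima.

Σℕ : (Fin n → ℕ) → ℕ
Σℕ = sum +-0-monoid

Σ-mono-≤ : {f g : Fin n → ℕ} → (∀ i → f i ≤ g i) → Σℕ f ≤ Σℕ g
Σ-mono-≤ {zero}  f≤g = z≤n
Σ-mono-≤ {suc n} f≤g = +-mono-≤ (f≤g zero) (Σ-mono-≤ (f≤g ∘ suc))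

Σ-mono-< : {f g : Fin n → ℕ} → (∀ i → f i ≤ g i) → ∀ i → f i < g i → Σℕ f < Σℕ g
Σ-mono-< f≤g zero    f<g = +-mono-<-≤ f<g (Σ-mono-≤ (f≤g ∘ suc))
Σ-mono-< f≤g (suc i) f<g = +-mono-≤-< (f≤g zero) (Σ-mono-< (f≤g ∘ suc) i f<g)

-- Accounts for one move of Resolver: only the copy `i` that he plays in becomes more expensive, by
-- one move.
Σ-≤-suc : {f g : Fin n → ℕ} → ∀ i → (∀ j → j ≢ i → f j ≤ g j) → f i ≤ suc (g i) →
          Σℕ f ≤ suc (Σℕ g)
Σ-≤-suc zero    f≤g fi≤ = +-mono-≤ fi≤ (Σ-mono-≤ λ j → f≤g (suc j) λ ())
Σ-≤-suc {g = g} (suc i) f≤g fi≤ =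
  ≤-trans (+-mono-≤ (f≤g zero λ ())
                    (Σ-≤-suc i (λ j j≢i → f≤g (suc j) λ { refl → j≢i refl }) fi≤))
          (ℕ.≤-reflexive (ℕ.+-suc (g zero) _))

Σ-const : ∀ n h → Σℕ {n} (λ _ → h) ≡ n * h
Σ-const zero    h = refl
Σ-const (suc n) h = cong (h +_) (Σ-const n h)

least : {A : Pred ℕ 0ℓ} → Decidable A → A k → ∃[ d ] (A d × ∀ j → A j → d ≤ j)
least A? a with A? 0
... | yes a₀ = 0 , a₀ , λ _ _ → z≤n
least {zero}  A? a | no ¬a₀ = contradiction a ¬a₀
least {suc k} A? a | no ¬a₀ with least (A? ∘ suc) a
... | d , ad , d≤ = suc d , ad , λ { zero    a₀ → contradiction a₀ ¬a₀
                                   ; (suc j) aj → s≤s (d≤ j aj) }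

-- Serves to find Spoiler's most costly reply among the free vertices `D`.
maximal-choice : {T : Set} (c : T → ℕ) {D : Pred (Fin n) 0ℓ} {Q : Fin n → T → Set} →
  Decidable D → ∃ D → (∀ u → D u → ∃[ t ] Q u t) →
  ∃[ t ] ((∃[ u ] (D u × Q u t)) × (∀ u → D u → ∃[ t′ ] (Q u t′ × c t′ ≤ c t)))
maximal-choice {n} {T} c {D} {Q} D? (u₀ , d₀) choose =
  proj₁ (pick best) , proj₁ (proj₂ (pick best)) ,
  λ u d → proj₁ (pick u) , proj₂ (proj₂ (pick u)) d ,
          All.lookup (f[xs]≤f[argmax] {f = c ∘ proj₁ ∘ pick} u₀ (allFin n)) (∈-allFin u)
  where
  pick : ∀ u → ∃[ t ] ((∃[ v ] (D v × Q v t)) × (D u → Q u t))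
  pick u with D? u
  ... | yes d = let (t , q) = choose u d in t , (u , d , q) , λ _ → q
  -- Outside `D` the choice at `u₀` is the default, so that `argmax` can run over all of `Fin n` and
  -- its value is still attained in `D`.
  ... | no ¬d = let (t , q) = choose u₀ d₀ in t , (u₀ , d₀ , q) , λ d → contradiction d ¬d

  best : Fin n
  best = argmax (c ∘ proj₁ ∘ pick) u₀ (allFin n)

other : 2 ≤ n → (i : Fin n) → ∃[ j ] i ≢ j
other (s≤s (s≤s z≤n)) zero    = suc zero , λ ()
other (s≤s (s≤s z≤n)) (suc i) = zero , λ ()

-- Distances and resolving sets

walk? : (X : Graph n) → ∀ x y → Decidable (Walk X x y)
walk? X x y zero = map′ (λ { refl → [] }) (λ { [] → refl }) (x ≟ y)
walk? X x y (suc k) =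
  map′ (λ (_ , a , w) → a ∷ w) (λ { (a ∷ w) → _ , a , w })
       (any? λ z → adj? X x z ×-dec walk? X z y k)

HasDistances : Graph n → Set
HasDistances X = ∀ x y → ∃[ d ] Distance X x y d

connected⇒hasDistances : Connected X → HasDistances X
connected⇒hasDistances {X = X} conn x y = least (walk? X x y) (proj₂ (conn x y))

diameter⇒hasDistances : ∀ {D} → Diameter X D → HasDistances X
diameter⇒hasDistances (dist , _) x y = let (d , Dd , _) = dist x y in d , Dd

distance-unique : ∀ {x y d e} → Distance X x y d → Distance X x y e → d ≡ e
distance-unique (w , d≤) (w′ , e≤) = ≤-antisym (d≤ _ w′) (e≤ _ w)

-- Distances are unique, so those in `Resolving` can be replaced by the ones from `dist`; only
-- finite quantifiers remain.
resolving? : HasDistances X → Decidable (Resolving X)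
resolving? {X = X} dist W =
  map′ (λ r x y x≢y → [ (λ x≡y → contradiction x≡y x≢y)
                      , (λ (z , z∈W , d≢e) →
                           z , z∈W , _ , _ , proj₂ (dist x z) , proj₂ (dist y z) , d≢e)
                      ]′ (r x y))
       to
       (all? λ x → all? λ y → (x ≟ y) ⊎-dec
          any? λ z → (z ∈? W) ×-dec ¬? (proj₁ (dist x z) ℕ.≟ proj₁ (dist y z)))
  where
  to : Resolving X W → ∀ x y →
       x ≡ y ⊎ ∃[ z ] (z ∈ W × proj₁ (dist x z) ≢ proj₁ (dist y z))
  to r x y with x ≟ y
  ... | yes x≡y = inj₁ x≡y
  ... | no  x≢y with r x y x≢y
  ...   | z , z∈W , d , e , Dd , De , d≢e =
    inj₂ (z , z∈W , λ eq → d≢e (trans (distance-unique Dd (proj₂ (dist x z)))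
                             (trans eq (distance-unique (proj₂ (dist y z)) De))))

resolving-mono : ∀ {W W′} → W ⊆ W′ → Resolving X W → Resolving X W′
resolving-mono W⊆ r x y x≢y with r x y x≢y
... | z , z∈W , rest = z , W⊆ z∈W , rest

-- Strategies of Resolver

won-mono : ∀ P Q → byResolver P ⊆ byResolver Q → Won X resolver P → Won X resolver Q
won-mono _ _ P⊆Q (W , res , W⊆P) = W , res , P⊆Q ∘ W⊆P

won⇒resolving : Won X resolver P → Resolving X (byResolver P)
won⇒resolving (W , res , W⊆) = resolving-mono W⊆ res

resolving⇒won : Resolving X (byResolver P) → Won X resolver P
resolving⇒won {P = P} res = byResolver P , res , ⊆-refl

won? : HasDistances X → ∀ P → Dec (Won X resolver P)
won? dist P =
  map′ (resolving⇒won {P = P}) (won⇒resolving {P = P}) (resolving? dist (byResolver P))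

free? : (P : Position n) → Decidable (Free P)
free? ⟨ A , B ⟩ v = ¬? (v ∈? A) ×-dec ¬? (v ∈? B)

-- Decidability in the bound lets `least` extract minimum numbers of moves. The mutual recursion
-- ends because each move of Resolver lowers the bound.
resolver-strategy? : HasDistances X → ∀ P → Decidable (λ k → Strategy X resolver k resolver P)
spoiler-strategy? : HasDistances X → ∀ P → Decidable (λ k → Strategy X resolver k spoiler P)

resolver-strategy? dist P k with won? dist P
... | yes w = yes (won w)
resolver-strategy? dist P zero | no ¬w = no λ { (won w) → ¬w w }
resolver-strategy? dist P (suc k) | no ¬w =
  map′ (λ (v , fr , s) → move v fr s)
       (λ { (won w) → contradiction w ¬w ; (move v fr s) → v , fr , s })
       (any? λ v → free? P v ×-dec spoiler-strategy? dist (select resolver v P) k)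

spoiler-strategy? dist P k with won? dist P
... | yes w = yes (won w)
... | no ¬w =
  map′ (uncurry reply)
       (λ { (won w) → contradiction w ¬w ; (reply fr f) → fr , f })
       (any? (free? P) ×-dec all? λ v →
          free? P v →-dec resolver-strategy? dist (select spoiler v P) k)

strategy? : HasDistances X → ∀ t P → Decidable (λ k → Strategy X resolver k t P)
strategy? dist resolver = resolver-strategy? dist
strategy? dist spoiler  = spoiler-strategy? dist

weaken : k ≤ k′ → Strategy X p k t P → Strategy X p k′ t P
weaken k≤ (won w) = won w
weaken (s≤s k≤) (move v fr s) = move v fr (weaken k≤ s)
weaken k≤ (reply fr f) = reply fr λ v fr′ → weaken k≤ (f v fr′)

-- Q is at least as good for Resolver as P.
infix 4 _⊑_
_⊑_ : Position n → Position n → Set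
P ⊑ Q = byResolver P ⊆ byResolver Q × bySpoiler Q ⊆ bySpoiler P

∪-⊆ : ∀ {A B C : Subset n} → A ⊆ C → B ⊆ C → A ∪ B ⊆ C
∪-⊆ {A = A} {B} A⊆ B⊆ x∈ = [ A⊆ , B⊆ ]′ (x∈p∪q⁻ A B x∈)

⁅⁆-⊆ : ∀ {A : Subset n} {v} → v ∈ A → ⁅ v ⁆ ⊆ A
⁅⁆-⊆ {v = v} v∈A x∈ rewrite x∈⁅y⁆⇒x≡y v x∈ = v∈A

∪-monoˡ-⊆ : ∀ {A B : Subset n} C → A ⊆ B → A ∪ C ⊆ B ∪ C
∪-monoˡ-⊆ {B = B} C A⊆B = ∪-⊆ (p⊆p∪q C ∘ A⊆B) (q⊆p∪q B C)

-- Used for positions with a full board, where there is no move left by which a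
-- strategy could be imitated.
strategy⇒won : ∀ Q → Strategy X resolver k t P → byResolver P ⊆ byResolver Q →
               (∀ {v} → v ∉ bySpoiler P → v ∈ byResolver Q) → Won X resolver Q
strategy⇒won {P = P} Q (won w) P⊆Q rest = won-mono P Q P⊆Q w
strategy⇒won Q (move v (_ , v∉B) s) P⊆Q rest =
  strategy⇒won Q s (∪-⊆ P⊆Q (⁅⁆-⊆ (rest v∉B))) rest
strategy⇒won Q (reply (v , fr) f) P⊆Q rest =
  strategy⇒won Q (f v fr) P⊆Q λ v∉ → rest (v∉ ∘ p⊆p∪q ⁅ v ⁆)

-- On a full board `Q`, whatever Spoiler does not own in `P` she does not own in `Q` either, so it
-- is Resolver's.
full⇒won : ∀ Q → ¬ ∃ (Free Q) → P ⊑ Q → Strategy X resolver k t P → Won X resolver Q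
full⇒won Q full (P⊆Q , Q⊆P) s = strategy⇒won Q s P⊆Q taken
  where
  taken : ∀ {v} → v ∉ _ → v ∈ byResolver Q
  taken {v} v∉B with v ∈? byResolver Q
  ... | yes v∈ = v∈
  ... | no  v∉ = contradiction (v , v∉ , v∉B ∘ Q⊆P) full

-- When the strategy for P selects a vertex that is already taken in Q, Resolver
-- plays an arbitrary one; when Spoiler selects in Q a vertex that she owns in P,
-- Resolver imagines an arbitrary reply of hers in P.
strategy-mono : P ⊑ Q → Strategy X resolver k t P → Strategy X resolver k t Q
strategy-mono {P = P} {Q = Q} (P⊆Q , _) (won w) = won (won-mono P Q P⊆Q w)
strategy-mono {Q = Q} P⊑Q s@(move _ _ _) with any? (free? Q)
... | no full = won (full⇒won Q full P⊑Q s)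
strategy-mono {Q = Q} (P⊆Q , Q⊆P) (move v (v∉A , v∉B) s) | yes (w , w-free)
  with v ∈? byResolver Q
... | yes v∈ = move w w-free
  (strategy-mono (∪-⊆ (p⊆p∪q ⁅ w ⁆ ∘ P⊆Q) (⁅⁆-⊆ (p⊆p∪q ⁅ w ⁆ v∈)) , Q⊆P) s)
... | no  v∉ = move v (v∉ , v∉B ∘ Q⊆P) (strategy-mono (∪-monoˡ-⊆ ⁅ v ⁆ P⊆Q , Q⊆P) s)
strategy-mono {Q = Q} P⊑Q s@(reply _ _) with any? (free? Q)
... | no full = won (full⇒won Q full P⊑Q s)
strategy-mono {P = P} {Q = Q} {X = X} {k = k} (P⊆Q , Q⊆P) (reply (w , w-free) f) | yes free =
  reply free answer
  where
  answer : ∀ v → Free Q v → Strategy X resolver k resolver (select spoiler v Q)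
  answer v (v∉A , _) with v ∈? bySpoiler P
  ... | yes v∈ =
    strategy-mono (P⊆Q , p⊆p∪q ⁅ w ⁆ ∘ ∪-⊆ Q⊆P (⁅⁆-⊆ v∈)) (f w w-free)
  ... | no v∉ = strategy-mono (P⊆Q , ∪-monoˡ-⊆ ⁅ v ⁆ Q⊆P) (f v (v∉A ∘ P⊆Q , v∉))

select-spoiler-⊑ : ∀ v (P : Position n) → select spoiler v P ⊑ P
select-spoiler-⊑ v P = ⊆-refl , p⊆p∪q ⁅ v ⁆

-- Resolver imagines some move of Spoiler and follows his reply to it; taking the imagined vertex
-- away from her can only help him.
skip : Strategy X resolver k spoiler P → Strategy X resolver k resolver P
skip (won w) = won w
skip {P = P} (reply (v , fr) f) = strategy-mono (select-spoiler-⊑ v P) (f v fr)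

-- An inversion with an equation for the bound, which will have the form `k i` and cannot be matched
-- against `suc`.
resolver-move : Strategy X resolver k resolver P → ¬ Won X resolver P →
  ∃[ k′ ] (k ≡ suc k′ ×
           ∃[ v ] (Free P v × Strategy X resolver k′ spoiler (select resolver v P)))
resolver-move (won w) ¬w = contradiction w ¬w
resolver-move (move v fr s) ¬w = _ , refl , v , fr , s

spoiler-move : Strategy X resolver k spoiler P → ¬ Won X resolver P → ∃ (Free P)
spoiler-move (won w) ¬w = contradiction w ¬w
spoiler-move (reply fr f) ¬w = fr

-- Vertices and positions of the corona

module _ {n m : ℕ} where

  vertex : CoronaVertex n m → Fin (n + n * m)
  vertex (inj₁ i)       = i ↑ˡ (n * m)
  vertex (inj₂ (i , u)) = n ↑ʳ combine i u

  decode-vertex : (a : CoronaVertex n m) → decode n m (vertex a) ≡ a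
  decode-vertex (inj₁ i) rewrite splitAt-↑ˡ n i (n * m) = refl
  decode-vertex (inj₂ (i , u)) rewrite splitAt-↑ʳ n (n * m) (combine i u) =
    cong inj₂ (remQuot-combine i u)

  vertex-decode : ∀ v → vertex (decode n m v) ≡ v
  vertex-decode v with splitAt n v in eq
  ... | inj₁ i = splitAt⁻¹-↑ˡ eq
  ... | inj₂ w = trans (cong (n ↑ʳ_) (combine-remQuot {n} m w)) (splitAt⁻¹-↑ʳ {n} eq)

  vertex-injective : {a b : CoronaVertex n m} → vertex a ≡ vertex b → a ≡ b
  vertex-injective {a = a} {b} eq =
    trans (sym (decode-vertex a)) (trans (cong (decode _ _) eq) (decode-vertex b))

  infix 8 _at_
  _at_ : Fin m → Fin n → Fin (n + n * m)
  u at i = vertex (inj₂ (i , u))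

  at-injectiveˡ : ∀ {u v : Fin m} {i j : Fin n} → u at i ≡ v at j → u ≡ v
  at-injectiveˡ = cong proj₂ ∘ inj₂-injective ∘ vertex-injective

  at-injectiveʳ : ∀ {u v : Fin m} {i j : Fin n} → u at i ≡ v at j → i ≡ j
  at-injectiveʳ = cong proj₁ ∘ inj₂-injective ∘ vertex-injective

  restrict : Fin n → Subset (n + n * m) → Subset m
  restrict i A = tabulate λ u → lookup A (u at i)

  ∈-restrict⁺ : ∀ {i : Fin n} {u : Fin m} {A} → u at i ∈ A → u ∈ restrict i A
  ∈-restrict⁺ {i = i} {u} {A} u∈ =
    lookup⇒[]= u _ (trans (lookup∘tabulate _ u) ([]=⇒lookup u∈))

  ∈-restrict⁻ : ∀ {i : Fin n} {u : Fin m} {A} → u ∈ restrict i A → u at i ∈ A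
  ∈-restrict⁻ {i = i} {u} {A} u∈ =
    lookup⇒[]= (u at i) A (trans (sym (lookup∘tabulate _ u)) ([]=⇒lookup u∈))

  restrict-mono : ∀ (i : Fin n) (A B : Subset (n + n * m)) →
                  A ⊆ B → restrict i A ⊆ restrict i B
  restrict-mono i A B A⊆B x∈ =
    ∈-restrict⁺ {A = B} (A⊆B (∈-restrict⁻ {A = A} x∈))

  restrict-⊥ : ∀ (i : Fin n) → restrict i ⊥ ⊆ ⊥
  restrict-⊥ i x∈ = contradiction (∈-restrict⁻ {A = ⊥} x∈) ∉⊥

  copy : Fin n → Position (n + n * m) → Position m
  copy i ⟨ A , B ⟩ = ⟨ restrict i A , restrict i B ⟩

  restrict-add : ∀ (i : Fin n) (u : Fin m) A →
                 restrict i (A ∪ ⁅ u at i ⁆) ≡ restrict i A ∪ ⁅ u ⁆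
  restrict-add i u A = ⊆-antisym to
    (∪-⊆ (restrict-mono i A (A ∪ _) (p⊆p∪q ⁅ u at i ⁆))
         (⁅⁆-⊆ (∈-restrict⁺ {A = A ∪ _} (q⊆p∪q A _ (x∈⁅x⁆ (u at i))))))
    where
    to : restrict i (A ∪ ⁅ u at i ⁆) ⊆ restrict i A ∪ ⁅ u ⁆
    to {x} x∈ with x∈p∪q⁻ A ⁅ u at i ⁆ (∈-restrict⁻ {A = A ∪ _} x∈)
    ... | inj₁ x∈A = p⊆p∪q ⁅ u ⁆ (∈-restrict⁺ {A = A} x∈A)
    ... | inj₂ x∈u rewrite at-injectiveˡ {u = x} {u} {i} {i} (x∈⁅y⁆⇒x≡y _ x∈u) =
      q⊆p∪q (restrict i A) _ (x∈⁅x⁆ u)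

  Outside : Fin n → Fin (n + n * m) → Set
  Outside i v = ∀ u → v ≢ u at i

  restrict-add-outside : ∀ (i : Fin n) v (A : Subset (n + n * m)) → Outside i v →
                         restrict i (A ∪ ⁅ v ⁆) ≡ restrict i A
  restrict-add-outside i v A out = ⊆-antisym to (restrict-mono i A (A ∪ _) (p⊆p∪q ⁅ v ⁆))
    where
    to : restrict i (A ∪ ⁅ v ⁆) ⊆ restrict i A
    to {x} x∈ with x∈p∪q⁻ A ⁅ v ⁆ (∈-restrict⁻ {A = A ∪ _} x∈)
    ... | inj₁ x∈A = ∈-restrict⁺ {A = A} x∈A
    ... | inj₂ x∈v = contradiction (sym (x∈⁅y⁆⇒x≡y v x∈v)) (out x)

  copy-select : ∀ p (i : Fin n) (u : Fin m) P →
                copy i (select p (u at i) P) ≡ select p u (copy i P)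
  copy-select resolver i u ⟨ A , B ⟩ = cong ⟨_, restrict i B ⟩ (restrict-add i u A)
  copy-select spoiler  i u ⟨ A , B ⟩ = cong ⟨ restrict i A ,_⟩ (restrict-add i u B)

  copy-select-outside : ∀ p {i : Fin n} {v} (P : Position (n + n * m)) →
                        Outside i v → copy i (select p v P) ≡ copy i P
  copy-select-outside resolver {i} ⟨ A , B ⟩ out =
    cong ⟨_, restrict i B ⟩ (restrict-add-outside i _ A out)
  copy-select-outside spoiler  {i} ⟨ A , B ⟩ out =
    cong ⟨ restrict i A ,_⟩ (restrict-add-outside i _ B out)

  copy-mono : ∀ (i : Fin n) {P Q : Position (n + n * m)} → P ⊑ Q → copy i P ⊑ copy i Q
  copy-mono i {P} {Q} (P⊆Q , Q⊆P) =
    restrict-mono i (byResolver P) (byResolver Q) P⊆Q ,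
    restrict-mono i (bySpoiler Q) (bySpoiler P) Q⊆P

  free-copy⁺ : ∀ (i : Fin n) (u : Fin m) P → Free P (u at i) → Free (copy i P) u
  free-copy⁺ i u ⟨ A , B ⟩ (u∉A , u∉B) = u∉A ∘ ∈-restrict⁻ {A = A} , u∉B ∘ ∈-restrict⁻ {A = B}

  free-copy⁻ : ∀ (i : Fin n) (u : Fin m) P → Free (copy i P) u → Free P (u at i)
  free-copy⁻ i u ⟨ A , B ⟩ (u∉A , u∉B) = u∉A ∘ ∈-restrict⁺ {A = A} , u∉B ∘ ∈-restrict⁺ {A = B}

  inCopy? : (v : Fin (n + n * m)) (i : Fin n) → Dec (∃[ u ] v ≡ u at i)
  inCopy? v i = any? λ u → v ≟ u at i

  outside-≢ : ∀ {u : Fin m} {i j : Fin n} → i ≢ j → Outside j (u at i)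
  outside-≢ i≢j _ eq = i≢j (at-injectiveʳ eq)

  -- Distances in the corona

  module _ (G : Graph n) (H : Graph m) where

    -- Walks on the sum type, where adjacency computes by matching on the endpoints instead of being
    -- blocked by `decode`.
    data CoronaWalk : CoronaVertex n m → CoronaVertex n m → ℕ → Set where
      []  : ∀ {a} → CoronaWalk a a 0
      _∷_ : ∀ {a b c k} → CoronaAdj G H a b → CoronaWalk b c k → CoronaWalk a c (suc k)

    decodeWalk : ∀ {v w k} → Walk (G ⊙ H) v w k → CoronaWalk (decode n m v) (decode n m w) k
    decodeWalk []      = []
    decodeWalk (a ∷ w) = a ∷ decodeWalk w

    encodeWalk : ∀ {a b k} → CoronaWalk a b k → Walk (G ⊙ H) (vertex a) (vertex b) k
    encodeWalk [] = []
    encodeWalk (_∷_ {a} {b} adj w) =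
      subst₂ (CoronaAdj G H) (sym (decode-vertex a)) (sym (decode-vertex b)) adj ∷ encodeWalk w

    encodeWalk′ : ∀ {v w k} → CoronaWalk (decode n m v) (decode n m w) k → Walk (G ⊙ H) v w k
    encodeWalk′ {v} {w} {k} p =
      subst₂ (λ v w → Walk (G ⊙ H) v w k) (vertex-decode v) (vertex-decode w) (encodeWalk p)

    decodeWalk′ : ∀ {a b k} → Walk (G ⊙ H) (vertex a) (vertex b) k → CoronaWalk a b k
    decodeWalk′ {a} {b} {k} w =
      subst₂ (λ a b → CoronaWalk a b k) (decode-vertex a) (decode-vertex b) (decodeWalk w)

    _++_ : ∀ {a b c k l} → CoronaWalk a b k → CoronaWalk b c l → CoronaWalk a c (k + l)
    []      ++ w′ = w′
    (a ∷ w) ++ w′ = a ∷ (w ++ w′)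

    liftG : ∀ {i j k} → Walk G i j k → CoronaWalk (inj₁ i) (inj₁ j) k
    liftG []      = []
    liftG (a ∷ w) = a ∷ liftG w

    liftH : ∀ {i u v k} → Walk H u v k → CoronaWalk (inj₂ (i , u)) (inj₂ (i , v)) k
    liftH []      = []
    liftH (a ∷ w) = (refl , a) ∷ liftH w

    corona-connected : Connected G → Connected (G ⊙ H)
    corona-connected conn v w =
      _ , encodeWalk′ (proj₂ (down (decode n m v)) ++
                       (liftG (proj₂ (conn _ _)) ++ proj₂ (up (decode n m w))))
      where
      root : CoronaVertex n m → Fin n
      root (inj₁ i)       = i
      root (inj₂ (i , u)) = i
      down : ∀ a → ∃[ k ] CoronaWalk a (inj₁ (root a)) k
      down (inj₁ i)       = _ , []
      down (inj₂ (i , u)) = _ , refl ∷ []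
      up : ∀ a → ∃[ k ] CoronaWalk (inj₁ (root a)) a k
      up (inj₁ i)       = _ , []
      up (inj₂ (i , u)) = _ , refl ∷ []

    -- The only way out of a copy is its vertex of `G`, and at least one step is spent on reaching
    -- it.
    exit-walk : ∀ {i u b k} → (∀ v → b ≢ inj₂ (i , v)) → CoronaWalk (inj₂ (i , u)) b k →
                ∃[ l ] (suc l ≤ k × CoronaWalk (inj₁ i) b l)
    exit-walk out [] = contradiction refl (out _)
    exit-walk out (_∷_ {b = inj₁ i} refl w) = _ , ≤-refl , w
    exit-walk out (_∷_ {b = inj₂ _} (refl , _) w) with exit-walk out w
    ... | l , l<k , w′ = l , ℕ.m≤n⇒m≤1+n l<k , w′

    -- A detour through `inj₁ i` takes two steps, so anything shorter stays in `H`. Longer walks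
    -- need no analysis: under diameter two they cannot beat a distance in `H`.
    inner-walk : ∀ {i u v k} → CoronaWalk (inj₂ (i , u)) (inj₂ (i , v)) k →
                 2 ≤ k ⊎ Walk H u v k
    inner-walk []                 = inj₂ []
    inner-walk ((_ , a) ∷ [])     = inj₂ (a ∷ [])
    inner-walk (_ ∷ (_ ∷ _))      = inj₁ (s≤s (s≤s z≤n))

    -- Says that `a` is closer to `c` than `b` is, in terms of walks, so that no exact distance has
    -- to be computed.
    Separates : CoronaVertex n m → CoronaVertex n m → CoronaVertex n m → Set
    Separates c a b = ∃[ d ] (CoronaWalk a c d × (∀ k → CoronaWalk b c k → d < k))

    -- Resolving sets of the corona and their traces on the copies.

    module _ (connG : Connected G) (2≤n : 2 ≤ n) (diam : Diameter H 2) where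

      coronaDistances : HasDistances (G ⊙ H)
      coronaDistances = connected⇒hasDistances (corona-connected connG)

      inner-distance : ∀ {u v d} i → Distance H u v d → Distance (G ⊙ H) (u at i) (v at i) d
      inner-distance {u} {v} i (w , d≤) = encodeWalk (liftH w) , λ k w′ →
        [ ≤-trans d≤2 , d≤ k ]′ (inner-walk (decodeWalk′ w′))
        where
        d≤2 = let (e , (w′ , _) , e≤2) = proj₁ diam u v in ≤-trans (d≤ e w′) e≤2

      -- A walk from `v` to `z` passes through vertex `i` of `G`; its part before that can be
      -- replaced by the edge from `u` to `i`.
      outer-distance-≤ : ∀ i u v {z d e} → Outside i z →
        Distance (G ⊙ H) (u at i) z d → Distance (G ⊙ H) (v at i) z e → d ≤ e
      outer-distance-≤ i u v {z} {d} {e} out (_ , d≤) (w , _) =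
        let (l , l<e , w′) = exit-walk out′
                               (subst (λ b → CoronaWalk b (decode n m z) e)
                                      (decode-vertex (inj₂ (i , v))) (decodeWalk w))
        in ≤-trans (d≤ (suc l) (encodeWalk′ (subst (λ b → CoronaWalk b (decode n m z) (suc l))
                     (sym (decode-vertex (inj₂ (i , u)))) (_∷_ {b = inj₁ i} refl w′)))) l<e
        where
        out′ : ∀ x → decode n m z ≢ inj₂ (i , x)
        out′ x eq = out x (trans (sym (vertex-decode z)) (cong vertex eq))

      -- A vertex outside the copy is equally far from `x` and `y`, so the one that tells them apart
      -- lies inside, where distances are those of `H`.
      restrict-resolving : ∀ {W} → Resolving (G ⊙ H) W → ∀ i → Resolving H (restrict i W)
      restrict-resolving {W} res i x y x≢y with res (x at i) (y at i) (x≢y ∘ at-injectiveˡ)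
      ... | z , z∈W , d , e , Dd , De , d≢e with inCopy? z i
      ...   | yes (u , refl) =
        let (d′ , Dd′ , _) = proj₁ diam x u
            (e′ , De′ , _) = proj₁ diam y u
        in u , ∈-restrict⁺ {A = W} z∈W , d′ , e′ , Dd′ , De′ , λ d′≡e′ →
           d≢e (trans (distance-unique Dd (inner-distance i Dd′))
                (trans d′≡e′ (distance-unique (inner-distance i De′) De)))
      ...   | no ∉i = contradiction (≤-antisym (outer-distance-≤ i x y out Dd De)
                                               (outer-distance-≤ i y x out De Dd)) d≢e
        where
        out : Outside i z
        out u z≡ = ∉i (u , z≡)

      separates⇒≢ : ∀ {x y z d e} → Separates (decode n m z) (decode n m x) (decode n m y) →
        Distance (G ⊙ H) x z d → Distance (G ⊙ H) y z e → d ≢ e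
      separates⇒≢ (k , w , k<) (_ , d≤) (w′ , _) refl =
        ℕ.<-irrefl refl (ℕ.≤-<-trans (d≤ k (encodeWalk′ w)) (k< _ (decodeWalk w′)))

      -- Two vertices at distance two are distinct and have to be told apart.
      resolving-nonempty : ∀ {W} → Resolving H W → ∃[ u ] u ∈ W
      resolving-nonempty res with proj₂ diam
      ... | x , y , (_ , 2≤) with res x y (λ { refl → contradiction (2≤ 0 []) λ () })
      ...   | z , z∈W , _ = z , z∈W

      module _ {W} (res : ∀ i → Resolving H (restrict i W)) where

        Separated : CoronaVertex n m → CoronaVertex n m → Set
        Separated a b = ∃[ c ] (vertex c ∈ W × (Separates c a b ⊎ Separates c b a))

        Separated-sym : ∀ {a b} → Separated a b → Separated b a
        Separated-sym (c , c∈W , inj₁ s) = c , c∈W , inj₂ s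
        Separated-sym (c , c∈W , inj₂ s) = c , c∈W , inj₁ s

        chosen : ∀ i → ∃[ u ] (u at i ∈ W)
        chosen i with resolving-nonempty (res i)
        ... | u , u∈ = u , ∈-restrict⁻ {A = W} u∈

        -- For distinct `i` and `j`, a chosen vertex of copy `i` is adjacent to `i` but at least two
        -- steps from copy `j`. For equal ones, a chosen vertex of another copy works, as walks to
        -- it from copy `i` pass through `i`; this uses a second vertex of `G`.
        separated-root-copy : ∀ i j u → Separated (inj₁ i) (inj₂ (j , u))
        separated-root-copy i j u with i ≟ j
        ... | no i≢j = let (w , w∈W) = chosen i in
          inj₂ (i , w) , w∈W , inj₁ (1 , refl ∷ [] , λ
            { _ []              → contradiction refl i≢j
            ; _ ((refl , _) ∷ []) → contradiction refl i≢j
            ; _ (_ ∷ (_ ∷ _))   → s≤s (s≤s z≤n) })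
        ... | yes refl =
          let (l , i≢l) = other 2≤n i
              (w , w∈W) = chosen l
              d , D , d≤ = coronaDistances (vertex (inj₁ i)) (w at l)
          in inj₂ (l , w) , w∈W , inj₁ (d , decodeWalk′ D , λ k w′ →
               let (k′ , k′<k , w″) = exit-walk (λ _ eq → i≢l (sym (cong proj₁ (inj₂-injective eq)))) w′
               in ℕ.≤-<-trans (d≤ k′ (encodeWalk w″)) k′<k)

        separated : ∀ a b → a ≢ b → Separated a b
        separated (inj₁ i) (inj₁ j) a≢b = let (w , w∈W) = chosen i in
          inj₂ (i , w) , w∈W , inj₁ (1 , refl ∷ [] , λ
            { _ (refl ∷ [])   → contradiction refl a≢b
            ; _ (_ ∷ (_ ∷ _)) → s≤s (s≤s z≤n) })
        separated (inj₁ i) (inj₂ (j , u)) _ = separated-root-copy i j u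
        separated (inj₂ (j , u)) (inj₁ i) _ = Separated-sym (separated-root-copy i j u)
        separated (inj₂ (i , u)) (inj₂ (j , v)) a≢b with i ≟ j
        -- From `u` the vertex `w` is reached in two steps through `i`, possibly not the shortest
        -- way, but copy `j` is at least three steps away.
        ... | no i≢j = let (w , w∈W) = chosen i in
          inj₂ (i , w) , w∈W , inj₁ (2 , _∷_ {b = inj₁ i} refl (refl ∷ []) , λ
            { _ []                → contradiction refl i≢j
            ; _ ((refl , _) ∷ []) → contradiction refl i≢j
            ; _ (_∷_ {b = inj₁ _} refl (refl ∷ []))             → contradiction refl i≢j
            ; _ (_∷_ {b = inj₂ _} (refl , _) ((refl , _) ∷ [])) → contradiction refl i≢j
            ; _ (_ ∷ (_ ∷ (_ ∷ _))) → s≤s (s≤s (s≤s z≤n)) })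
        ... | yes refl with res i u v (λ { refl → a≢b refl })
        ...   | z , z∈ , d , e , Dd , De , d≢e with ℕ.<-cmp d e
        ...     | tri< d<e _ _ = inj₂ (i , z) , ∈-restrict⁻ {A = W} z∈ , inj₁
                  (d , liftH (proj₁ Dd) , λ k w →
                     ℕ.<-≤-trans d<e (proj₂ (inner-distance i De) k (encodeWalk w)))
        ...     | tri≈ _ d≡e _ = contradiction d≡e d≢e
        ...     | tri> _ _ e<d = inj₂ (i , z) , ∈-restrict⁻ {A = W} z∈ , inj₂
                  (e , liftH (proj₁ De) , λ k w →
                     ℕ.<-≤-trans e<d (proj₂ (inner-distance i Dd) k (encodeWalk w)))

        copies-resolving : Resolving (G ⊙ H) W
        copies-resolving x y x≢y
          with separated (decode n m x) (decode n m y)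
                 (λ eq → x≢y (trans (sym (vertex-decode x))
                                    (trans (cong vertex eq) (vertex-decode y))))
        ... | c , c∈W , sep =
          vertex c , c∈W , _ , _ , Dx , Dy ,
          [ (λ s → separates⇒≢ (moved s) Dx Dy)
          , (λ s → separates⇒≢ (moved s) Dy Dx ∘ sym) ]′ sep
          where
          Dx = proj₂ (coronaDistances x (vertex c))
          Dy = proj₂ (coronaDistances y (vertex c))
          moved : ∀ {a b} → Separates c a b → Separates (decode n m (vertex c)) a b
          moved {a} {b} = subst (λ c → Separates c a b) (sym (decode-vertex c))

      won-copy : ∀ P → Won (G ⊙ H) resolver P → ∀ i → Won H resolver (copy i P)
      won-copy P w i =
        resolving⇒won {P = copy i P} (restrict-resolving (won⇒resolving {P = P} w) i)

      won-corona : ∀ P → (∀ i → Won H resolver (copy i P)) → Won (G ⊙ H) resolver P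
      won-corona P w =
        resolving⇒won {P = P} (copies-resolving λ i → won⇒resolving {P = copy i P} (w i))

      -- The game on the corona

      -- Inside the copy, Spoiler's move is covered by the strategy; elsewhere Resolver gains a move
      -- here, which `skip` absorbs.
      after-spoiler : ∀ {k P v} i → Free P v → Strategy H resolver k spoiler (copy i P) →
                      Strategy H resolver k resolver (copy i (select spoiler v P))
      after-spoiler i fr (won w) = won w
      after-spoiler {P = P} {v} i fr s@(reply _ f) with inCopy? v i
      ... | yes (u , refl) =
        subst (Strategy H resolver _ resolver) (sym (copy-select spoiler i u P))
              (f u (free-copy⁺ i u P fr))
      ... | no ∉i = subst (Strategy H resolver _ resolver)
        (sym (copy-select-outside spoiler P λ u v≡ → ∉i (u , v≡))) (skip s)

      copyWon? : ∀ P i → Dec (Won H resolver (copy i P))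
      copyWon? P i = won? (diameter⇒hasDistances diam) (copy i P)

      -- Chooses where Resolver answers `v`: in its own copy if that is unfinished, otherwise in any
      -- unfinished copy.
      focus : ∀ P v → ∃[ i ] ¬ Won H resolver (copy i P) →
              ∃[ i ] (¬ Won H resolver (copy i P) ×
                      ∀ j → j ≢ i → Won H resolver (copy j P) ⊎ Outside j v)
      focus P v (i₀ , ¬w₀) with any? (inCopy? v)
      ... | no ∉ = i₀ , ¬w₀ , λ j _ → inj₂ λ u v≡ → ∉ (j , u , v≡)
      ... | yes (i , u , refl) with copyWon? P i
      ...   | no ¬w = i , ¬w , λ j j≢i → inj₂ (outside-≢ (j≢i ∘ sym))
      ...   | yes w = i₀ , ¬w₀ , others
        where
        others : ∀ j → j ≢ i₀ → Won H resolver (copy j P) ⊎ Outside j (u at i)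
        others j _ with j ≟ i
        ... | yes refl = inj₁ w
        ... | no j≢i   = inj₂ (outside-≢ (j≢i ∘ sym))

      -- `k` is the budget of moves left in each copy. `combine-resolver-first` is the state after
      -- Spoiler's move: Resolver answers in copy `i` and can still afford to be second in the
      -- others.
      combine-spoiler-first : ∀ K P (k : Fin n → ℕ) → Σℕ k ≤ K →
        (∀ i → Strategy H resolver (k i) spoiler (copy i P)) →
        Strategy (G ⊙ H) resolver K spoiler P

      combine-resolver-first : ∀ K P (k : Fin n → ℕ) → Σℕ k ≤ K → ∀ i →
        ¬ Won H resolver (copy i P) → Strategy H resolver (k i) resolver (copy i P) →
        (∀ j → j ≢ i → Strategy H resolver (k j) spoiler (copy j P)) →
        Strategy (G ⊙ H) resolver K resolver P

      combine-spoiler-first K P k Σk≤K s with all? (copyWon? P)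
      ... | yes w = won (won-corona P w)
      -- An unfinished copy with Spoiler to move has a free vertex, as `reply` demands.
      ... | no ¬w = reply (_ , free-copy⁻ i₀ u₀ P fr₀) answer
        where
        unfinished = ¬∀⟶∃¬ n _ (copyWon? P) ¬w
        i₀ = proj₁ unfinished
        u₀ = proj₁ (spoiler-move (s i₀) (proj₂ unfinished))
        fr₀ = proj₂ (spoiler-move (s i₀) (proj₂ unfinished))

        answer : ∀ v → Free P v → Strategy (G ⊙ H) resolver K resolver (select spoiler v P)
        answer v fr with focus P v unfinished
        ... | i , ¬wᵢ , others =
          combine-resolver-first K (select spoiler v P) k Σk≤K i ¬wᵢ
            (after-spoiler i fr (s i))
            λ j j≢i → [ won
                      , (λ out → subst (Strategy H resolver (k j) spoiler)
                                       (sym (copy-select-outside spoiler P out)) (s j))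
                      ]′ (others j j≢i)

      combine-resolver-first K P k Σk≤K i ¬w sᵢ s with resolver-move sᵢ ¬w
      ... | κ , kᵢ≡ , u , fr , t = finish K Σk≤K
        where
        P′ = select resolver (u at i) P

        remaining : ∀ j → ∃[ l ] (Strategy H resolver l spoiler (copy j P′) ×
                                  l ≤ k j × (j ≡ i → l < k j))
        remaining j with j ≟ i
        ... | yes refl =
          κ , subst (Strategy H resolver κ spoiler) (sym (copy-select resolver i u P)) t ,
          ℕ.<⇒≤ κ<k , λ _ → κ<k
          where
          κ<k : κ < k i
          κ<k = ℕ.≤-reflexive (sym kᵢ≡)
        ... | no j≢i =
          k j , subst (Strategy H resolver (k j) spoiler)
                      (sym (copy-select-outside resolver P (outside-≢ (j≢i ∘ sym)))) (s j j≢i) ,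
          ≤-refl , λ j≡i → contradiction j≡i j≢i

        l : Fin n → ℕ
        l = proj₁ ∘ remaining

        Σl<Σk : Σℕ l < Σℕ k
        Σl<Σk = Σ-mono-< (proj₁ ∘ proj₂ ∘ proj₂ ∘ remaining) i
                          (proj₂ (proj₂ (proj₂ (remaining i))) refl)

        -- `K` is split only now that the sum is known to drop strictly, which rules out zero.
        finish : ∀ K → Σℕ k ≤ K → Strategy (G ⊙ H) resolver K resolver P
        finish zero    Σk≤ = contradiction (ℕ.<-≤-trans Σl<Σk Σk≤) λ ()
        finish (suc K) Σk≤ = move (u at i) (free-copy⁻ i u P fr)
          (combine-spoiler-first K P′ l (s≤s⁻¹ (≤-trans Σl<Σk Σk≤))
             (proj₁ ∘ proj₂ ∘ remaining))

      -- Spoiler answers every move in the copy where it was made, with the reply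
      -- that costs Resolver the most moves in that copy; i is the copy in which
      -- she owes an answer in split-spoiler-first.
      split-resolver-first : Strategy (G ⊙ H) resolver K resolver P →
        ∃[ k ] (Σℕ k ≤ K × ∀ i → Strategy H resolver (k i) resolver (copy i P))

      split-spoiler-first : Strategy (G ⊙ H) resolver K spoiler P → ∀ i →
        ∃[ k ] (Σℕ k ≤ K × Strategy H resolver (k i) spoiler (copy i P) ×
                ∀ j → j ≢ i → Strategy H resolver (k j) resolver (copy j P))

      -- Where Spoiler answers when Resolver selects a vertex of `G`.
      someCopy : Fin n
      someCopy = fromℕ< (≤-trans (s≤s z≤n) 2≤n)

      Σ-zero : ∀ {K} → Σℕ {n} (λ _ → 0) ≤ K
      Σ-zero = ≤-trans (ℕ.≤-reflexive (trans (Σ-const n 0) (ℕ.*-zeroʳ n))) z≤n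

      split-resolver-first {P = P} (won w) = (λ _ → 0) , Σ-zero , won ∘ won-copy P w
      split-resolver-first {suc K} {P = P} (move v fr s) with any? (inCopy? v)
      ... | yes (i , u , refl) with split-spoiler-first s i
      ...   | k , Σk≤K , sᵢ , sⱼ =
        proj₁ ∘ before , ≤-trans (Σ-≤-suc i (λ j → proj₁ (proj₂ (proj₂ (before j))))
                                            (proj₂ (proj₂ (proj₂ (before i))) refl))
                                 (s≤s Σk≤K) , proj₁ ∘ proj₂ ∘ before
        where
        before : ∀ j → ∃[ l ] (Strategy H resolver l resolver (copy j P) ×
                               (j ≢ i → l ≤ k j) × (j ≡ i → l ≤ suc (k j)))
        before j with j ≟ i
        ... | yes refl =
          suc (k i) , move u (free-copy⁺ i u P fr)
                        (subst (Strategy H resolver _ spoiler) (copy-select resolver i u P) sᵢ) ,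
          (λ j≢i → contradiction refl j≢i) , λ _ → ≤-refl
        ... | no j≢i =
          k j , subst (Strategy H resolver _ resolver)
                      (copy-select-outside resolver P (outside-≢ (j≢i ∘ sym))) (sⱼ j j≢i) ,
          (λ _ → ≤-refl) , λ _ → ℕ.n≤1+n _
      -- A vertex of `G` changes no copy, so the budgets after the move also serve before it.
      split-resolver-first {suc K} {P = P} (move v fr s) | no ∉ with split-spoiler-first s someCopy
      ... | k , Σk≤K , sᵢ , sⱼ = k , ℕ.m≤n⇒m≤1+n Σk≤K , before
        where
        before : ∀ j → Strategy H resolver (k j) resolver (copy j P)
        before j = subst (Strategy H resolver (k j) resolver)
                         (copy-select-outside resolver P λ u v≡ → ∉ (j , u , v≡)) (both j)
          where
          both : ∀ j → Strategy H resolver (k j) resolver (copy j (select resolver v P))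
          both j with j ≟ someCopy
          ... | yes refl = skip sᵢ
          ... | no j≢i   = sⱼ j j≢i

      split-spoiler-first {P = P} (won w) i =
        (λ _ → 0) , Σ-zero , won (won-copy P w i) , λ j _ → won (won-copy P w j)
      split-spoiler-first {K} {P = P} (reply (v , fr) f) i with any? (free? (copy i P))
      -- Spoiler cannot answer in a full copy, so she plays any free vertex; a full copy that
      -- Resolver can win is already won.
      ... | no full with split-resolver-first (f v fr)
      ...   | k , Σk≤K , s =
        k , Σk≤K , won (full⇒won (copy i P) full ⊑i (s i)) ,
        λ j _ → strategy-mono (copy-mono j (select-spoiler-⊑ v P)) (s j)
        where
        ⊑i : copy i (select spoiler v P) ⊑ copy i P
        ⊑i = copy-mono i (select-spoiler-⊑ v P)
      split-spoiler-first {K} {P = P} (reply _ f) i | yes free =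
        worstReply (maximal-choice (λ k → k i) (free? (copy i P)) free
                      λ u fr → split-resolver-first (f (u at i) (free-copy⁻ i u P fr)))
        where
        After : Fin m → (Fin n → ℕ) → Set
        After u k = Σℕ k ≤ K ×
          ∀ j → Strategy H resolver (k j) resolver (copy j (select spoiler (u at i) P))

        worstReply :
          ∃[ k ] ((∃[ u ] (Free (copy i P) u × After u k)) ×
                  (∀ u → Free (copy i P) u → ∃[ k′ ] (After u k′ × k′ i ≤ k i))) →
          ∃[ k ] (Σℕ k ≤ K × Strategy H resolver (k i) spoiler (copy i P) ×
                  ∀ j → j ≢ i → Strategy H resolver (k j) resolver (copy j P))
        -- All budgets come from the single reply `u`, which keeps their sum within `K`. Other
        -- replies matter only in copy `i`, where theirs are at most `k i`.
        worstReply (k , (u , _ , Σk≤K , s) , worst) =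
          k , Σk≤K , reply free answer ,
          λ j _ → strategy-mono (copy-mono j (select-spoiler-⊑ (u at i) P)) (s j)
          where
          answer : ∀ v → Free (copy i P) v →
                   Strategy H resolver (k i) resolver (select spoiler v (copy i P))
          answer v fr =
            let (_ , (_ , s′) , k′≤k) = worst v fr
            in weaken k′≤k (subst (Strategy H resolver _ resolver) (copy-select spoiler i v P) (s′ i))

      -- The two bounds and the theorem.

      corona-upper : ∀ h → WinsWithin H resolver spoiler h →
                     WinsWithin (G ⊙ H) resolver spoiler (n * h)
      corona-upper h s =
        combine-spoiler-first (n * h) start (λ _ → h) (ℕ.≤-reflexive (Σ-const n h))
          λ i → strategy-mono (⊥⊆ , restrict-⊥ i) s

      corona-lower : ∀ h → (∀ j → WinsWithin H resolver resolver j → h ≤ j) →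
                     ∀ j → WinsWithin (G ⊙ H) resolver resolver j → n * h ≤ j
      corona-lower h h≤ j s with split-resolver-first s
      ... | k , Σk≤j , sᵢ = ≤-trans (ℕ.≤-reflexive (sym (Σ-const n h)))
        (≤-trans (Σ-mono-≤ λ i → h≤ (k i) (strategy-mono (restrict-⊥ i , ⊥⊆) (sᵢ i))) Σk≤j)

minMoves : HasDistances X → ∀ {first k} → WinsWithin X resolver first k →
           ∃[ r ] IsMinMoves X first r
minMoves dist {first} = least (strategy? dist first start)

proposition4p2 : ∀ {n m : ℕ} (G : Graph n) (H : Graph m) →
    Connected G → 2 ≤ n → Diameter H 2 → HasOutcome H 𝓡 →
    (∃[ r ] ∃[ r′ ] ∃[ h′ ]
    (R-MB≡ (G ⊙ H) r × R′-MB≡ (G ⊙ H) r′ × R′-MB≡ H h′ ×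
    r ≤ r′ × r′ ≤ n * h′)) ×
    (∀ h → R-MB≡ H h → R′-MB≡ H h →
    R-MB≡ (G ⊙ H) (n * h) × R′-MB≡ (G ⊙ H) (n * h))
proposition4p2 {n} G H connG 2≤n diam outcome =
  (let (h′ , win , h′≤) = minMoves (diameter⇒hasDistances diam) (proj₂ (outcome spoiler))
       win′ = upper h′ win
       (r , r-win , r≤) = minMoves dist (skip win′)
       (r′ , r′-win , r′≤) = minMoves dist win′
   in r , r′ , h′ , (r-win , r≤) , (r′-win , r′≤) , (win , h′≤) ,
      r≤ r′ (skip r′-win) , r′≤ (n * h′) win′) ,
  λ h (_ , h≤) (win , _) →
    -- By `skip` a win in the S-game is one in the R-game with the same bound, so both bounds hold
    -- for both games.
    (skip (upper h win) , lower h h≤) , (upper h win , λ j s → lower h h≤ j (skip s))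
  where
  dist = coronaDistances G H connG 2≤n diam
  upper = corona-upper G H connG 2≤n diam
  lower = corona-lower G H connG 2≤n diam
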